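{- There exists a sequence of functions $f_m:\{0,1\}^m\to\{0,1\}$, probability distributions $\mu_m$ on $\{0,1\}^m$, and error parameters $0<\varepsilon_m<1$ such that, as $m\to\infty$, $$\overline{D}^{\mu_m}_0(f_m)=O(1)\quad\text{and}\quad D^{\mu_m}_{\varepsilon_m}(f_m)=\Omega(m).$$
   Context: A deterministic query algorithm is a decision tree that adaptively queries single bits of the input; a randomized query algorithm $\mathcal{A}$ is a probability distribution over deterministic ones, $\mathcal{A}_r$ being the tree for internal randomness $r$ and $|\mathcal{A}_r(x)|$ the number of queries it makes on input $x$. For a function $f$ on bit strings and a distribution $\mu$ on its inputs: $\overline{D}^\mu_0(f)$ is the infimum of $\mathbf{E}_{x\sim\mu,r}[|\mathcal{A}_r(x)|]$ over randomized query algorithms $\mathcal{A}$ with $\Pr_{x\sim\mu,r}[\mathcal{A}_r(x)\neq f(x)]=0$; and $D^\mu_\varepsilon(f)$ is the minimum, over deterministic decision trees $T$ with $\Pr_{x\sim\mu}[T(x)\ne f(x)]\le\varepsilon$, of the maximum number of queries made by $T$ on an input in $\operatorname{supp}(\mu)$. -}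

module Defs where

open import Data.Bool.Base using (Bool; true; false; if_then_else_; _xor_)
open import Data.Fin.Base using (Fin)
open import Data.Integer.Base as ℤ using ()
open import Data.Nat.Base as ℕ using (ℕ; zero; suc)
import Data.Nat.Properties as ℕ
open import Data.Product using (Σ; ∃; ∃-syntax; _×_; _,_)
open import Data.Rational.Base as ℚ using (ℚ; 0ℚ; 1ℚ; ½; 1/_; Positive; positive)
import Data.Rational.Properties as ℚ
open import Data.Rational.Solver using (module +-*-Solver)
open import Data.Vec.Base using (Vec; []; _∷_; lookup)
open import Relation.Binary.PropositionalEquality
  using (_≡_; refl; sym; trans; cong; subst)

IsCauchy : (ℕ → ℚ) → Set
IsCauchy x = ∀ (ε : ℚ) → 0ℚ ℚ.< ε →
  ∃[ N ] (∀ i j → N ℕ.≤ i → N ℕ.≤ j → ℚ.∣ x i ℚ.- x j ∣ ℚ.≤ ε)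

private
  half-pos : ∀ ε → 0ℚ ℚ.< ε → 0ℚ ℚ.< ½ ℚ.* ε
  half-pos ε ε>0 =
    ℚ.positive⁻¹ (½ ℚ.* ε) {{ℚ.pos*pos⇒pos ½ ε {{positive ε>0}}}}

  half+half : ∀ ε → ½ ℚ.* ε ℚ.+ ½ ℚ.* ε ≡ ε
  half+half ε = trans (sym (ℚ.*-distribʳ-+ ε ½ ½)) (ℚ.*-identityˡ ε)

  ∣sum∣-≤ : ∀ a b c ε → a ≡ b ℚ.+ c →
    ℚ.∣ b ∣ ℚ.≤ ½ ℚ.* ε → ℚ.∣ c ∣ ℚ.≤ ½ ℚ.* ε → ℚ.∣ a ∣ ℚ.≤ ε
  ∣sum∣-≤ _ b c ε refl b≤ c≤ = subst (ℚ.∣ b ℚ.+ c ∣ ℚ.≤_) (half+half ε)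
    (ℚ.≤-trans (ℚ.∣p+q∣≤∣p∣+∣q∣ b c) (ℚ.+-mono-≤ b≤ c≤))

+-cauchy : ∀ x y → IsCauchy x → IsCauchy y → IsCauchy (λ n → x n ℚ.+ y n)
+-cauchy x y cx cy ε ε>0 =
  let M , hx = cx (½ ℚ.* ε) (half-pos ε ε>0)
      N , hy = cy (½ ℚ.* ε) (half-pos ε ε>0)
  in M ℕ.⊔ N , λ i j i≥ j≥ →
    ∣sum∣-≤ _ (x i ℚ.- x j) (y i ℚ.- y j) ε (split (x i) (y i) (x j) (y j))
      (hx i j (ℕ.m⊔n≤o⇒m≤o M N i≥) (ℕ.m⊔n≤o⇒m≤o M N j≥))
      (hy i j (ℕ.m⊔n≤o⇒n≤o M N i≥) (ℕ.m⊔n≤o⇒n≤o M N j≥))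
  where
  open +-*-Solver
  split : ∀ a b c d → (a ℚ.+ b) ℚ.- (c ℚ.+ d) ≡ (a ℚ.- c) ℚ.+ (b ℚ.- d)
  split = solve 4 (λ a b c d → (a :+ b) :- (c :+ d) := (a :- c) :+ (b :- d)) refl

cauchy-bounded : ∀ x → IsCauchy x →
  ∃[ B ] (Positive B × ∃[ N ] (∀ n → N ℕ.≤ n → ℚ.∣ x n ∣ ℚ.≤ B))
cauchy-bounded x cx =
  let N , h = cx 1ℚ (ℚ.positive⁻¹ 1ℚ)
  in 1ℚ ℚ.+ ℚ.∣ x N ∣
   , ℚ.pos+nonNeg⇒pos 1ℚ ℚ.∣ x N ∣ {{ℚ.nonNegative (ℚ.0≤∣p∣ (x N))}}
   , N
   , λ n n≥N → ℚ.≤-trans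
       (subst (ℚ._≤ ℚ.∣ x n ℚ.- x N ∣ ℚ.+ ℚ.∣ x N ∣) (cong ℚ.∣_∣ (cancel (x n) (x N)))
         (ℚ.∣p+q∣≤∣p∣+∣q∣ (x n ℚ.- x N) (x N)))
       (ℚ.+-monoˡ-≤ ℚ.∣ x N ∣ (h n N n≥N ℕ.≤-refl))
  where
  open +-*-Solver
  cancel : ∀ a b → (a ℚ.- b) ℚ.+ b ≡ a
  cancel = solve 2 (λ a b → (a :- b) :+ b := a) refl

private
  scaled : ∀ B → Positive B → ∀ ε → 0ℚ ℚ.< ε →
    ∃[ δ ] (0ℚ ℚ.< δ × B ℚ.* δ ≡ ε)
  scaled B B>0 ε ε>0 =
    (1/ B) ℚ.* ε
    , ℚ.positive⁻¹ _ {{ℚ.pos*pos⇒pos (1/ B) {{ℚ.1/pos⇒pos B}} ε {{positive ε>0}}}}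
    , trans (sym (ℚ.*-assoc B (1/ B) ε))
        (trans (cong (ℚ._* ε) (ℚ.*-inverseʳ B)) (ℚ.*-identityˡ ε))
    where instance
      B-pos : Positive B
      B-pos = B>0
      B≢0 : ℚ.NonZero B
      B≢0 = ℚ.pos⇒nonZero B

  ∣*∣-≤ : ∀ B δ p q → ℚ.∣ p ∣ ℚ.≤ B → ℚ.∣ q ∣ ℚ.≤ δ → Positive B →
    ℚ.∣ p ℚ.* q ∣ ℚ.≤ B ℚ.* δ
  ∣*∣-≤ B δ p q p≤ q≤ B>0 = subst (ℚ._≤ _) (sym (ℚ.∣p*q∣≡∣p∣*∣q∣ p q))
    (ℚ.≤-trans
      (ℚ.*-monoʳ-≤-nonNeg ℚ.∣ q ∣ {{ℚ.nonNegative (ℚ.0≤∣p∣ q)}} p≤)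
      (ℚ.*-monoˡ-≤-nonNeg B {{ℚ.pos⇒nonNeg B {{B>0}}}} q≤))

*-cauchy : ∀ x y → IsCauchy x → IsCauchy y → IsCauchy (λ n → x n ℚ.* y n)
*-cauchy x y cx cy ε ε>0 =
  let A , A>0 , K , bx = cauchy-bounded x cx
      B , B>0 , L , by = cauchy-bounded y cy
      α , α>0 , Aα≡ = scaled A A>0 (½ ℚ.* ε) (half-pos ε ε>0)
      β , β>0 , Bβ≡ = scaled B B>0 (½ ℚ.* ε) (half-pos ε ε>0)
      M , hy = cy α α>0
      N , hx = cx β β>0
  in (K ℕ.⊔ L) ℕ.⊔ (M ℕ.⊔ N) , λ i j i≥ j≥ →
    let i≥KL = ℕ.m⊔n≤o⇒m≤o (K ℕ.⊔ L) (M ℕ.⊔ N) i≥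
        j≥KL = ℕ.m⊔n≤o⇒m≤o (K ℕ.⊔ L) (M ℕ.⊔ N) j≥
        i≥MN = ℕ.m⊔n≤o⇒n≤o (K ℕ.⊔ L) (M ℕ.⊔ N) i≥
        j≥MN = ℕ.m⊔n≤o⇒n≤o (K ℕ.⊔ L) (M ℕ.⊔ N) j≥
    in ∣sum∣-≤ _ (x i ℚ.* (y i ℚ.- y j)) (y j ℚ.* (x i ℚ.- x j)) ε
      (split (x i) (y i) (x j) (y j))
      (subst (_ ℚ.≤_) Aα≡
        (∣*∣-≤ A α (x i) (y i ℚ.- y j) (bx i (ℕ.m⊔n≤o⇒m≤o K L i≥KL))
          (hy i j (ℕ.m⊔n≤o⇒m≤o M N i≥MN) (ℕ.m⊔n≤o⇒m≤o M N j≥MN)) A>0))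
      (subst (_ ℚ.≤_) Bβ≡
        (∣*∣-≤ B β (y j) (x i ℚ.- x j) (by j (ℕ.m⊔n≤o⇒n≤o K L j≥KL))
          (hx i j (ℕ.m⊔n≤o⇒n≤o M N i≥MN) (ℕ.m⊔n≤o⇒n≤o M N j≥MN)) B>0))
  where
  open +-*-Solver
  split : ∀ a b c d → (a ℚ.* b) ℚ.- (c ℚ.* d) ≡ a ℚ.* (b ℚ.- d) ℚ.+ d ℚ.* (a ℚ.- c)
  split = solve 4 (λ a b c d →
    (a :* b) :- (c :* d) := a :* (b :- d) :+ d :* (a :- c)) refl

record ℝ : Set where
  constructor mkℝ
  field
    approx   : ℕ → ℚ
    isCauchy : IsCauchy approx

open ℝ public

infix  4 _≤_ _<_ _≈_
infixl 6 _+_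
infixl 7 _*_

_+_ : ℝ → ℝ → ℝ
mkℝ x cx + mkℝ y cy = mkℝ (λ n → x n ℚ.+ y n) (+-cauchy x y cx cy)

_*_ : ℝ → ℝ → ℝ
mkℝ x cx * mkℝ y cy = mkℝ (λ n → x n ℚ.* y n) (*-cauchy x y cx cy)

_≤_ : ℝ → ℝ → Set
x ≤ y = ∀ (ε : ℚ) → 0ℚ ℚ.< ε →
  ∃[ N ] (∀ n → N ℕ.≤ n → approx x n ℚ.≤ approx y n ℚ.+ ε)

_<_ : ℝ → ℝ → Set
x < y = ∃[ δ ] (0ℚ ℚ.< δ ×
  ∃[ N ] (∀ n → N ℕ.≤ n → approx x n ℚ.+ δ ℚ.≤ approx y n))

-- Equality of reals: distinct Cauchy sequences may represent the same real.
_≈_ : ℝ → ℝ → Set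
x ≈ y = x ≤ y × y ≤ x

fromℚ : ℚ → ℝ
fromℚ q = mkℝ (λ _ → q) λ ε ε>0 →
  0 , λ _ _ _ _ → subst (ℚ._≤ ε) (cong ℚ.∣_∣ (sym (ℚ.+-inverseʳ q))) (ℚ.<⇒≤ ε>0)

fromℕ : ℕ → ℝ
fromℕ n = fromℚ ((ℤ.+ n) ℚ./ 1)

0ℝ 1ℝ : ℝ
0ℝ = fromℚ 0ℚ
1ℝ = fromℚ 1ℚ

IsInfimum : (ℝ → Set) → ℝ → Set
IsInfimum S v = (∀ s → S s → v ≤ s) × (∀ l → (∀ s → S s → l ≤ s) → l ≤ v)

IsMinimum : (ℕ → Set) → ℕ → Set
IsMinimum S d = S d × (∀ s → S s → d ℕ.≤ s)

partialSum : (ℕ → ℝ) → ℕ → ℝ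
partialSum a zero    = 0ℝ
partialSum a (suc n) = partialSum a n + a n

-- The series Σᵣ a r converges to s.
HasSum : (ℕ → ℝ) → ℝ → Set
HasSum a s = ∀ (ε : ℚ) → 0ℚ ℚ.< ε → ∃[ N ] (∀ n → N ℕ.≤ n →
  partialSum a n ≤ s + fromℚ ε × s ≤ partialSum a n + fromℚ ε)

-- Asymptotic notation as m → ∞, for nonnegative g and h (hence no absolute
-- values).
_=O_ : (ℕ → ℝ) → (ℕ → ℝ) → Set
g =O h = ∃[ C ] ∃[ N ] (∀ m → N ℕ.≤ m → g m ≤ C * h m)

_=Ω_ : (ℕ → ℝ) → (ℕ → ℝ) → Set
g =Ω h = ∃[ c ] (0ℝ < c × ∃[ N ] (∀ m → N ℕ.≤ m → c * h m ≤ g m))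

Cube : ℕ → Set
Cube m = Vec Bool m

∑ : ∀ {m} → (Cube m → ℝ) → ℝ
∑ {zero}  F = F []
∑ {suc m} F = ∑ (λ x → F (false ∷ x)) + ∑ (λ x → F (true ∷ x))

record Distribution (m : ℕ) : Set where
  field
    mass    : Cube m → ℝ
    mass≥0  : ∀ x → 0ℝ ≤ mass x
    mass-∑  : ∑ mass ≈ 1ℝ

open Distribution public

_∈supp_ : ∀ {m} → Cube m → Distribution m → Set
x ∈supp μ = 0ℝ < mass μ x

Pr : ∀ {m} → Distribution m → (Cube m → Bool) → ℝ
Pr μ event = ∑ λ x → if event x then mass μ x else 0ℝ

𝔼 : ∀ {m} → Distribution m → (Cube m → ℕ) → ℝ
𝔼 μ X = ∑ λ x → mass μ x * fromℕ (X x)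

data DecisionTree (m : ℕ) : Set where
  output : Bool → DecisionTree m
  -- query i t₀ t₁ continues with t₀ if bit i is 0 and with t₁ if it is 1.
  query  : Fin m → DecisionTree m → DecisionTree m → DecisionTree m

run : ∀ {m} → DecisionTree m → Cube m → Bool
run (output b)      x = b
run (query i t₀ t₁) x = if lookup x i then run t₁ x else run t₀ x

queries : ∀ {m} → DecisionTree m → Cube m → ℕ
queries (output b)      x = 0
queries (query i t₀ t₁) x = suc (if lookup x i then queries t₁ x else queries t₀ x)

-- The event T(x) ≠ f(x).
errs : ∀ {m} → (Cube m → Bool) → DecisionTree m → Cube m → Bool
errs f T x = run T x xor f x

-- There are countably many decision trees, so the internal randomness r can be
-- taken to range over ℕ.
record RandomizedAlgorithm (m : ℕ) : Set where
  field
    prob      : ℕ → ℝ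
    prob≥0    : ∀ r → 0ℝ ≤ prob r
    prob-sum  : HasSum prob 1ℝ
    tree      : ℕ → DecisionTree m

open RandomizedAlgorithm public

-- Pr_{x∼μ,r}[𝒜ᵣ(x) ≠ f(x)] = p
ErrorProbability : ∀ {m} → Distribution m → (Cube m → Bool) →
  RandomizedAlgorithm m → ℝ → Set
ErrorProbability μ f 𝒜 p = HasSum (λ r → prob 𝒜 r * Pr μ (errs f (tree 𝒜 r))) p

-- 𝔼_{x∼μ,r}[|𝒜ᵣ(x)|] = c.  The expectation may be infinite, in which case no
-- such c exists; such algorithms do not affect the infimum below.
ExpectedQueries : ∀ {m} → Distribution m → RandomizedAlgorithm m → ℝ → Set
ExpectedQueries μ 𝒜 c = HasSum (λ r → prob 𝒜 r * 𝔼 μ (queries (tree 𝒜 r))) c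

-- The average-case zero-error complexity of f under μ equals v.
IsD̄₀ : ∀ {m} → Distribution m → (Cube m → Bool) → ℝ → Set
IsD̄₀ {m} μ f = IsInfimum λ c →
  Σ (RandomizedAlgorithm m) λ 𝒜 → ErrorProbability μ f 𝒜 0ℝ × ExpectedQueries μ 𝒜 c

-- The maximum number of queries made by T on an input in supp(μ) equals q.
IsMaxQueries : ∀ {m} → Distribution m → DecisionTree m → ℕ → Set
IsMaxQueries μ T q =
  (∃[ x ] (x ∈supp μ × queries T x ≡ q)) × (∀ x → x ∈supp μ → queries T x ℕ.≤ q)

-- The distributional complexity of f under μ with error ε equals d.
IsD : ∀ {m} → Distribution m → ℝ → (Cube m → Bool) → ℕ → Set
IsD {m} μ ε f = IsMinimum λ q →
  Σ (DecisionTree m) λ T → Pr μ (errs f T) ≤ ε × IsMaxQueries μ T q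

{-# OPTIONS --safe #-}
-- Let f(b, y) = b ∧ parity(y) on n + 1 bits, where (0, y) has weight n and
-- (1, y) has weight 1.  Asking for b first costs 1 on every (0, y) and n + 1 on
-- every (1, y), less than 2 on average.  No exact tree T has a smaller average,
-- already for each y separately: on (1, y) it reads all of y; if it also reads b
-- there, its costs on (0, y) and (1, y) are at least 1 and n + 1; otherwise it
-- takes the same path on both inputs, both costs are at least n, and
-- n · n + n ≥ n · 1 + (n + 1) for n ≥ 2.
-- With ε below the smallest probability, error ε means exact, and an exact tree
-- reads all n + 1 bits of any (1, y) with parity(y) = 1.
--
-- Randomization does not help.  With C the cost of the optimal exact tree (in
-- integer weights), C ≤ cost(T) + C · err(T) holds for every tree T, since
-- err(T) ≥ 1 unless T is exact.  This is linear, so it can be averaged over r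
-- without deciding which trees have positive probability.
module Submission where

open import Defs
open import Data.Bool.Base using (Bool; true; false; if_then_else_; _∧_; _xor_; not)
import Data.Bool.Properties as Bool
open import Data.Empty using (⊥-elim)
open import Data.Fin.Base using (Fin; zero; suc)
import Data.Fin.Properties as Fin
open import Data.Integer.Base as ℤ using ()
import Data.Integer.Properties as ℤ
open import Data.List.Base using (List; []; _∷_; length)
import Data.List.Base as List
import Data.List.Membership.DecPropositional as DecMembership
open import Data.List.Membership.Propositional using (_∈_; _∉_)
open import Data.List.Relation.Unary.Any using (here; there; index)
open import Data.List.Relation.Unary.Any.Properties using (lookup-index)
open import Data.Nat.Base as ℕ using (ℕ; zero; suc; z≤n; s≤s)
import Data.Nat.Coprimality as Coprimality
import Data.Nat.Properties as ℕ
import Data.Nat.Solver as ℕSolver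
open import Data.Product using (Σ; ∃-syntax; _×_; _,_; proj₁; proj₂)
open import Data.Rational.Base as ℚ
  using (ℚ; mkℚ; 0ℚ; 1ℚ; ½; 1/_; Positive; NonNegative)
import Data.Rational.Properties as ℚ
open import Data.Rational.Solver using (module +-*-Solver)
open import Data.Vec.Base using ([]; _∷_; lookup; replicate; _[_]%=_)
import Data.Vec.Properties as Vec
open import Function.Base using (_∘_)
open import Function.Definitions using (Injective)
open import Relation.Binary.Bundles using (Preorder)
open import Relation.Binary.PropositionalEquality
  using (_≡_; _≢_; refl; sym; trans; cong; cong₂; subst; subst₂)
import Relation.Binary.Reasoning.Preorder
open import Relation.Nullary using (Dec; yes; no)
open import Relation.Nullary.Decidable using (decidable-stable)

-- Order and limits of Cauchy reals

half+half : ∀ q → ½ ℚ.* q ℚ.+ ½ ℚ.* q ≡ q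
half+half = solve 1 (λ q → con ½ :* q :+ con ½ :* q := q) refl
  where open +-*-Solver

half-pos : ∀ {q} → 0ℚ ℚ.< q → 0ℚ ℚ.< ½ ℚ.* q
half-pos {q} q>0 = ℚ.positive⁻¹ _ {{ℚ.pos*pos⇒pos ½ q {{ℚ.positive q>0}}}}

quotient-pos : ∀ p .{{_ : Positive p}} {q} → 0ℚ ℚ.< q →
  ∃[ δ ] (0ℚ ℚ.< δ × p ℚ.* δ ≡ q)
quotient-pos p {q} q>0 =
  (1/ p) ℚ.* q
  , ℚ.positive⁻¹ _ {{ℚ.pos*pos⇒pos (1/ p) {{ℚ.1/pos⇒pos p}} q {{ℚ.positive q>0}}}}
  , trans (sym (ℚ.*-assoc p (1/ p) q))
      (trans (cong (ℚ._* q) (ℚ.*-inverseʳ p)) (ℚ.*-identityˡ q))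
  where instance
    p≢0 : ℚ.NonZero p
    p≢0 = ℚ.pos⇒nonZero p

infix 4 _≋_

-- Finer than _≈_, but every equality of reals needed here holds termwise.
_≋_ : ℝ → ℝ → Set
x ≋ y = ∀ n → approx x n ≡ approx y n

≋⇒≤ : ∀ {x y} → x ≋ y → x ≤ y
≋⇒≤ {x} {y} x≋y ε ε>0 = 0 , λ n _ →
  ℚ.≤-trans (ℚ.≤-reflexive (trans (x≋y n) (sym (ℚ.+-identityʳ _))))
    (ℚ.+-monoʳ-≤ (approx y n) (ℚ.<⇒≤ ε>0))

≋⇒≥ : ∀ {x y} → x ≋ y → y ≤ x
≋⇒≥ {x} {y} x≋y = ≋⇒≤ {y} {x} (sym ∘ x≋y)

≤-refl : ∀ {x} → x ≤ x
≤-refl {x} = ≋⇒≤ {x} {x} λ _ → refl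

≤-trans : ∀ {x y z} → x ≤ y → y ≤ z → x ≤ z
≤-trans {x} {y} {z} x≤y y≤z ε ε>0 =
  let M , h = x≤y (½ ℚ.* ε) (half-pos ε>0)
      N , k = y≤z (½ ℚ.* ε) (half-pos ε>0)
  in M ℕ.⊔ N , λ n n≥ → ℚ.≤-trans (h n (ℕ.m⊔n≤o⇒m≤o M N n≥))
    (ℚ.≤-trans (ℚ.+-monoˡ-≤ (½ ℚ.* ε) (k n (ℕ.m⊔n≤o⇒n≤o M N n≥)))
      (ℚ.≤-reflexive (trans (ℚ.+-assoc (approx z n) _ _)
        (cong (approx z n ℚ.+_) (half+half ε)))))

+-mono-≤ : ∀ {x y z w} → x ≤ y → z ≤ w → x + z ≤ y + w
+-mono-≤ {x} {y} {z} {w} x≤y z≤w ε ε>0 =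
  let M , h = x≤y (½ ℚ.* ε) (half-pos ε>0)
      N , k = z≤w (½ ℚ.* ε) (half-pos ε>0)
  in M ℕ.⊔ N , λ n n≥ →
    ℚ.≤-trans
      (ℚ.+-mono-≤ (h n (ℕ.m⊔n≤o⇒m≤o M N n≥)) (k n (ℕ.m⊔n≤o⇒n≤o M N n≥)))
      (ℚ.≤-reflexive (regroup (approx y n) (approx w n) ε))
  where
  open +-*-Solver
  regroup : ∀ a b e →
    (a ℚ.+ ½ ℚ.* e) ℚ.+ (b ℚ.+ ½ ℚ.* e) ≡ (a ℚ.+ b) ℚ.+ e
  regroup = solve 3 (λ a b e →
    (a :+ con ½ :* e) :+ (b :+ con ½ :* e) := (a :+ b) :+ e) refl

fromℚ-*-monoʳ-≤ : ∀ q .{{_ : NonNegative q}} {x y} → x ≤ y →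
  fromℚ q * x ≤ fromℚ q * y
fromℚ-*-monoʳ-≤ q {x} {y} x≤y ε ε>0 =
  -- Dividing by `1ℚ ℚ.+ q` rather than `q` covers `q` = 0 as well; then `q ℚ.* δ` is still at most
  -- `ε`.
  let δ , δ>0 , eq = quotient-pos (1ℚ ℚ.+ q) {{ℚ.pos+nonNeg⇒pos 1ℚ q}} ε>0
      N , h = x≤y δ δ>0
      qδ≤ε : q ℚ.* δ ℚ.≤ ε
      qδ≤ε = subst (q ℚ.* δ ℚ.≤_) eq
        (ℚ.*-monoʳ-≤-nonNeg δ {{ℚ.nonNegative (ℚ.<⇒≤ δ>0)}}
          (ℚ.≤-trans (ℚ.≤-reflexive (sym (ℚ.+-identityˡ q)))
            (ℚ.+-monoˡ-≤ q (ℚ.nonNegative⁻¹ 1ℚ))))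
  in N , λ n n≥ → ℚ.≤-trans (ℚ.*-monoˡ-≤-nonNeg q (h n n≥))
    (ℚ.≤-trans (ℚ.≤-reflexive (ℚ.*-distribˡ-+ q (approx y n) δ))
      (ℚ.+-monoʳ-≤ (q ℚ.* approx y n) qδ≤ε))

≤-preorder : Preorder _ _ _
≤-preorder = record
  { Carrier = ℝ ; _≈_ = _≋_ ; _≲_ = _≤_
  ; isPreorder = record
    { isEquivalence = record
      { refl = λ _ → refl
      ; sym = λ x≋y n → sym (x≋y n)
      ; trans = λ x≋y y≋z n → trans (x≋y n) (y≋z n)
      }
    ; reflexive = λ {x} {y} → ≋⇒≤ {x} {y}
    ; trans = λ {x} {y} {z} → ≤-trans {x} {y} {z}
    }
  }

module ≤-Reasoning = Relation.Binary.Reasoning.Preorder ≤-preorder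

fromℚ-mono-≤ : ∀ {p q} → p ℚ.≤ q → fromℚ p ≤ fromℚ q
fromℚ-mono-≤ {p} {q} p≤q ε ε>0 = 0 , λ _ _ →
  ℚ.≤-trans p≤q (ℚ.≤-trans (ℚ.≤-reflexive (sym (ℚ.+-identityʳ q)))
    (ℚ.+-monoʳ-≤ q (ℚ.<⇒≤ ε>0)))

-- A nonnegative real may have negative approximations, so termwise multiplication fails. Instead
-- `q` splits as `p` + (`q` - `p`), and the second summand scales `x≥0`.
fromℚ-*-monoˡ-≤ : ∀ {p q x} → 0ℝ ≤ x → p ℚ.≤ q → fromℚ p * x ≤ fromℚ q * x
fromℚ-*-monoˡ-≤ {p} {q} {x} x≥0 p≤q =
  begin
    fromℚ p * x                          ≈⟨ (λ n → pad p (q ℚ.- p) (approx x n)) ⟩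
    fromℚ p * x + fromℚ (q ℚ.- p) * 0ℝ
      ≲⟨ +-mono-≤ {fromℚ p * x} {fromℚ p * x}
           {fromℚ (q ℚ.- p) * 0ℝ} {fromℚ (q ℚ.- p) * x} (≤-refl {fromℚ p * x})
           (fromℚ-*-monoʳ-≤ (q ℚ.- p) {{ℚ.nonNegative 0≤q-p}} {0ℝ} {x} x≥0) ⟩
    fromℚ p * x + fromℚ (q ℚ.- p) * x    ≈⟨ (λ n → merge p q (approx x n)) ⟩
    fromℚ q * x                          ∎
  where
  open ≤-Reasoning
  open +-*-Solver
  0≤q-p : 0ℚ ℚ.≤ q ℚ.- p
  0≤q-p = subst (ℚ._≤ q ℚ.- p) (ℚ.+-inverseʳ p) (ℚ.+-monoˡ-≤ (ℚ.- p) p≤q)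
  pad : ∀ a b c → a ℚ.* c ≡ a ℚ.* c ℚ.+ b ℚ.* 0ℚ
  pad = solve 3 (λ a b c → a :* c := a :* c :+ b :* con 0ℚ) refl
  merge : ∀ a b c → a ℚ.* c ℚ.+ (b ℚ.- a) ℚ.* c ≡ b ℚ.* c
  merge = solve 3 (λ a b c → a :* c :+ (b :- a) :* c := b :* c) refl

-- The factor `K` lets several errors of size `ε` be collected before the limit. Half of the slack
-- pays for `K ℚ.* δ`, half for the slack in the definition of `_≤_`.
≤-limit : ∀ {x y} K .{{_ : Positive K}} →
  (∀ ε → 0ℚ ℚ.< ε → x ≤ y + fromℚ (K ℚ.* ε)) → x ≤ y
≤-limit {x} {y} K h ε ε>0 =
  let δ , δ>0 , eq = quotient-pos K (half-pos ε>0)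
      N , k = h δ δ>0 (½ ℚ.* ε) (half-pos ε>0)
  in N , λ n n≥ → ℚ.≤-trans (k n n≥) (ℚ.≤-reflexive
    (trans (cong (λ t → (approx y n ℚ.+ t) ℚ.+ ½ ℚ.* ε) eq)
      (trans (ℚ.+-assoc (approx y n) _ _) (cong (approx y n ℚ.+_) (half+half ε)))))

fromℚ-cancel-≤ : ∀ {p q} → fromℚ p ≤ fromℚ q → ∀ ε → 0ℚ ℚ.< ε → p ℚ.≤ q ℚ.+ ε
fromℚ-cancel-≤ p≤q ε ε>0 = let N , h = p≤q ε ε>0 in h N ℕ.≤-refl

partialSum-mono-≤ : ∀ (p a b : ℕ → ℝ) L M .{{_ : NonNegative M}} →
  (∀ r → fromℚ L * p r ≤ b r + fromℚ M * a r) →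
  ∀ n → fromℚ L * partialSum p n ≤ partialSum b n + fromℚ M * partialSum a n
partialSum-mono-≤ p a b L M h zero = ≋⇒≤ {fromℚ L * 0ℝ} {0ℝ + fromℚ M * 0ℝ} λ _ → zeros L M
  where
  open +-*-Solver
  zeros : ∀ l m → l ℚ.* 0ℚ ≡ 0ℚ ℚ.+ m ℚ.* 0ℚ
  zeros = solve 2 (λ l m → l :* con 0ℚ := con 0ℚ :+ m :* con 0ℚ) refl
partialSum-mono-≤ p a b L M h (suc n) =
  begin
    fromℚ L * (P + p n)
      ≈⟨ (λ k → ℚ.*-distribˡ-+ L (approx P k) (approx (p n) k)) ⟩
    fromℚ L * P + fromℚ L * p n
      ≲⟨ +-mono-≤ {fromℚ L * P} {B + fromℚ M * A} {fromℚ L * p n} {b n + fromℚ M * a n}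
           (partialSum-mono-≤ p a b L M h n) (h n) ⟩
    (B + fromℚ M * A) + (b n + fromℚ M * a n)
      ≈⟨ (λ k → regroup (approx B k) (approx A k) (approx (b n) k) (approx (a n) k) M) ⟩
    (B + b n) + fromℚ M * (A + a n) ∎
  where
  open ≤-Reasoning
  P = partialSum p n
  A = partialSum a n
  B = partialSum b n
  open +-*-Solver
  regroup : ∀ s t c d m → (s ℚ.+ m ℚ.* t) ℚ.+ (c ℚ.+ m ℚ.* d) ≡
    (s ℚ.+ c) ℚ.+ m ℚ.* (t ℚ.+ d)
  regroup = solve 5 (λ s t c d m → (s :+ m :* t) :+ (c :+ m :* d) :=
    (s :+ c) :+ m :* (t :+ d)) refl

-- Summing the termwise inequality over r turns `p` into 1, `a` into 0 and `b` into `c`. Cutting the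
-- three series at one common index costs `ε` each, scaled by `L`, `M` and 1, hence the factor 1 +
-- (M + L).
HasSum-lower-bound : ∀ (p a b : ℕ → ℝ) {c} L M .{{_ : NonNegative L}} .{{_ : NonNegative M}} →
  HasSum p 1ℝ → HasSum a 0ℝ → HasSum b c →
  (∀ r → fromℚ L * p r ≤ b r + fromℚ M * a r) → fromℚ L ≤ c
HasSum-lower-bound p a b {c} L M Σp Σa Σb h =
  ≤-limit {fromℚ L} {c} (1ℚ ℚ.+ (M ℚ.+ L))
    {{ℚ.pos+nonNeg⇒pos 1ℚ (M ℚ.+ L) {{ℚ.nonNeg+nonNeg⇒nonNeg M L}}}} λ ε ε>0 →
  let Np , hp = Σp ε ε>0
      Na , ha = Σa ε ε>0
      Nb , hb = Σb ε ε>0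
      n = Np ℕ.⊔ (Na ℕ.⊔ Nb)
      P = partialSum p n
      A = partialSum a n
      B = partialSum b n
      e = fromℚ ε
      1≤P+e = proj₂ (hp n (ℕ.m≤m⊔n Np _))
      A≤0+e = proj₁ (ha n (ℕ.≤-trans (ℕ.m≤m⊔n Na Nb) (ℕ.m≤n⊔m Np _)))
      B≤c+e = proj₁ (hb n (ℕ.≤-trans (ℕ.m≤n⊔m Na Nb) (ℕ.m≤n⊔m Np _)))
  in begin
    fromℚ L                           ≈⟨ (λ _ → sym (ℚ.*-identityʳ L)) ⟩
    fromℚ L * 1ℝ                      ≲⟨ fromℚ-*-monoʳ-≤ L {1ℝ} {P + e} 1≤P+e ⟩
    fromℚ L * (P + e)                 ≈⟨ (λ k → ℚ.*-distribˡ-+ L (approx P k) ε) ⟩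
    fromℚ L * P + fromℚ L * e
      ≲⟨ +-mono-≤ {fromℚ L * P} {B + fromℚ M * A} {fromℚ L * e} {fromℚ L * e}
           (partialSum-mono-≤ p a b L M h n) (≤-refl {fromℚ L * e}) ⟩
    (B + fromℚ M * A) + fromℚ L * e
      ≲⟨ +-mono-≤ {B + fromℚ M * A} {(c + e) + fromℚ M * (0ℝ + e)} {fromℚ L * e} {fromℚ L * e}
           (+-mono-≤ {B} {c + e} {fromℚ M * A} {fromℚ M * (0ℝ + e)} B≤c+e
             (fromℚ-*-monoʳ-≤ M {A} {0ℝ + e} A≤0+e))
           (≤-refl {fromℚ L * e}) ⟩
    ((c + e) + fromℚ M * (0ℝ + e)) + fromℚ L * e
      ≈⟨ (λ k → collect (approx c k) ε L M) ⟩
    c + fromℚ ((1ℚ ℚ.+ (M ℚ.+ L)) ℚ.* ε) ∎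
  where
  open ≤-Reasoning
  open +-*-Solver
  collect : ∀ c e l m →
    ((c ℚ.+ e) ℚ.+ m ℚ.* (0ℚ ℚ.+ e)) ℚ.+ l ℚ.* e ≡ c ℚ.+ (1ℚ ℚ.+ (m ℚ.+ l)) ℚ.* e
  collect = solve 4 (λ c e l m →
    ((c :+ e) :+ m :* (con 0ℚ :+ e)) :+ l :* e := c :+ (con 1ℚ :+ (m :+ l)) :* e) refl

-- Deterministic trees as randomized algorithms, and zero-error complexity

pointMass : ℕ → ℝ
pointMass zero    = 1ℝ
pointMass (suc r) = 0ℝ

HasSum-pointMass-* : ∀ x {v} → x ≋ v → HasSum (λ r → pointMass r * x) v
-- The partial sum at 0 is empty; from index 1 on all partial sums agree with `v` termwise.
HasSum-pointMass-* x {v} x≋v ε ε>0 = 1 , λ where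
    (suc n) _ → below {partialSum a (suc n)} {v} (partial n)
              , below {v} {partialSum a (suc n)} (sym ∘ partial n)
  where
  a : ℕ → ℝ
  a r = pointMass r * x
  partial : ∀ n → partialSum a (suc n) ≋ v
  partial zero    k = trans (ℚ.+-identityˡ _) (trans (ℚ.*-identityˡ _) (x≋v k))
  partial (suc n) k =
    trans (cong₂ ℚ._+_ (partial n k) (ℚ.*-zeroˡ (approx x k))) (ℚ.+-identityʳ _)
  below : ∀ {x y} → x ≋ y → x ≤ y + fromℚ ε
  below {x} {y} x≋y = begin
    x            ≈⟨ x≋y ⟩
    y            ≈⟨ (λ k → sym (ℚ.+-identityʳ (approx y k))) ⟩
    y + 0ℝ       ≲⟨ +-mono-≤ {y} {y} {0ℝ} {fromℚ ε} (≤-refl {y}) (fromℚ-mono-≤ (ℚ.<⇒≤ ε>0)) ⟩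
    y + fromℚ ε  ∎
    where open ≤-Reasoning

HasSum-cong : ∀ {a b s} → (∀ r → a r ≋ b r) → HasSum a s → HasSum b s
HasSum-cong {a} {b} {s} a≋b Σa ε ε>0 = let N , h = Σa ε ε>0 in N , λ n n≥ →
    ≤-trans {partialSum b n} {partialSum a n} {s + fromℚ ε}
      (≋⇒≥ {partialSum a n} {partialSum b n} (partial n)) (proj₁ (h n n≥))
  , ≤-trans {s} {partialSum a n + fromℚ ε} {partialSum b n + fromℚ ε} (proj₂ (h n n≥))
      (≋⇒≤ {partialSum a n + fromℚ ε} {partialSum b n + fromℚ ε}
        λ k → cong (ℚ._+ ε) (partial n k))
  where
  partial : ∀ n → partialSum a n ≋ partialSum b n
  partial zero    k = refl
  partial (suc n) k = cong₂ ℚ._+_ (partial n k) (a≋b n k)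

always : ∀ {m} → DecisionTree m → RandomizedAlgorithm m
always T = record
  { prob     = pointMass
  ; prob≥0   = λ { zero → fromℚ-mono-≤ (ℚ.nonNegative⁻¹ 1ℚ) ; (suc r) → ≤-refl {0ℝ} }
  ; prob-sum = HasSum-cong {λ r → pointMass r * 1ℝ} {pointMass} {1ℝ} (λ r k → ℚ.*-identityʳ (approx (pointMass r) k))
                 (HasSum-pointMass-* 1ℝ {1ℝ} (λ _ → refl))
  ; tree     = λ _ → T
  }

always-HasSum : ∀ {m} T (F : DecisionTree m → ℝ) {v} → F T ≋ v →
  HasSum (λ r → prob (always T) r * F (tree (always T) r)) v
always-HasSum T F {v} FT≋v = generalized (prob (always T)) (tree (always T)) refl refl
  where
  -- Comparing prob (always T) with pointMass under HasSum would unfold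
  -- rational arithmetic, so the two are identified before _*_ is applied.
  generalized : ∀ p t → p ≡ pointMass → t ≡ (λ _ → T) → HasSum (λ r → p r * F (t r)) v
  generalized _ _ refl refl = HasSum-pointMass-* (F T) {v} FT≋v

-- The penalized inequality, scaled by the probability of each r and summed, bounds every competitor
-- from below: its penalties sum to 0. The infimum is attained, by `always T₀`.
penalized⇒IsD̄₀ : ∀ {m} (μ : Distribution m) f
  (err  : DecisionTree m → ℚ) → (∀ T → Pr μ (errs f T) ≋ fromℚ (err T)) →
  (mean : DecisionTree m → ℚ) → (∀ T → 𝔼 μ (queries T) ≋ fromℚ (mean T)) →
  ∀ T₀ → err T₀ ≡ 0ℚ → ∀ C .{{_ : NonNegative C}} .{{_ : NonNegative (mean T₀)}} →
  (∀ T → mean T₀ ℚ.≤ mean T ℚ.+ C ℚ.* err T) →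
  IsD̄₀ μ f (fromℚ (mean T₀))
penalized⇒IsD̄₀ {m} μ f err Pr≋err mean 𝔼≋mean T₀ err≡0 C penalized =
  lower , λ l l≤ → l≤ (fromℚ (mean T₀))
    ( always T₀
    , always-HasSum T₀ (λ T → Pr μ (errs f T)) {0ℝ} (λ k → trans (Pr≋err T₀ k) err≡0)
    , always-HasSum T₀ (λ T → 𝔼 μ (queries T)) {fromℚ (mean T₀)} (𝔼≋mean T₀))
  where
  open ≤-Reasoning
  open +-*-Solver
  distribute : ∀ q c e p →
    (q ℚ.+ c ℚ.* e) ℚ.* p ≡ p ℚ.* q ℚ.+ c ℚ.* (p ℚ.* e)
  distribute = solve 4 (λ q c e p →
    (q :+ c :* e) :* p := p :* q :+ c :* (p :* e)) refl

  term : ∀ p → 0ℝ ≤ p → ∀ T →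
    fromℚ (mean T₀) * p ≤ p * 𝔼 μ (queries T) + fromℚ C * (p * Pr μ (errs f T))
  term p p≥0 T = begin
    fromℚ (mean T₀) * p
      ≲⟨ fromℚ-*-monoˡ-≤ {mean T₀} {mean T ℚ.+ C ℚ.* err T} {p} p≥0 (penalized T) ⟩
    fromℚ (mean T ℚ.+ C ℚ.* err T) * p
      ≈⟨ (λ k → distribute (mean T) C (err T) (approx p k)) ⟩
    p * fromℚ (mean T) + fromℚ C * (p * fromℚ (err T))
      ≈⟨ (λ k → cong₂ (λ q e → approx p k ℚ.* q ℚ.+ C ℚ.* (approx p k ℚ.* e))
           (sym (𝔼≋mean T k)) (sym (Pr≋err T k))) ⟩
    p * 𝔼 μ (queries T) + fromℚ C * (p * Pr μ (errs f T)) ∎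

  lower : ∀ c → (Σ (RandomizedAlgorithm m) λ 𝒜 →
    ErrorProbability μ f 𝒜 0ℝ × ExpectedQueries μ 𝒜 c) → fromℚ (mean T₀) ≤ c
  lower c (𝒜 , error≡0 , expected≡c) =
    HasSum-lower-bound (prob 𝒜) (λ r → prob 𝒜 r * Pr μ (errs f (tree 𝒜 r)))
      (λ r → prob 𝒜 r * 𝔼 μ (queries (tree 𝒜 r))) {c} (mean T₀) C
      (prob-sum 𝒜) error≡0 expected≡c λ r → term (prob 𝒜 r) (prob≥0 𝒜 r) (tree 𝒜 r)

-- Integer weights on the cube

ι : ℕ → ℚ
ι n = (ℤ.+ n) ℚ./ 1

-- Division normalizes through a gcd that is stuck for a variable `n`; the explicit fraction lets
-- rational arithmetic compute.
ι-normal : ∀ n → ι n ≡ mkℚ (ℤ.+ n) 0 (Coprimality.sym (Coprimality.1-coprimeTo n))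
ι-normal n = ℚ.normalize-coprime (Coprimality.sym (Coprimality.1-coprimeTo n))

ι-+ : ∀ a b → ι (a ℕ.+ b) ≡ ι a ℚ.+ ι b
ι-+ a b rewrite ι-normal a | ι-normal b =
  ℚ./-cong (cong₂ ℤ._+_ (sym (ℤ.*-identityʳ (ℤ.+ a))) (sym (ℤ.*-identityʳ (ℤ.+ b)))) refl

ι-* : ∀ a b → ι (a ℕ.* b) ≡ ι a ℚ.* ι b
ι-* a b rewrite ι-normal a | ι-normal b = ℚ./-cong (ℤ.pos-* a b) refl

ι-mono-≤ : ∀ {a b} → a ℕ.≤ b → ι a ℚ.≤ ι b
ι-mono-≤ {a} {b} a≤b rewrite ι-normal a | ι-normal b =
  ℚ.*≤* (ℤ.*-monoʳ-≤-nonNeg (ℤ.+ 1) (ℤ.+≤+ a≤b))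

ι-nonNeg : ∀ n → NonNegative (ι n)
ι-nonNeg n = ℚ.normalize-nonNeg n 1

total : ∀ {m} → (Cube m → ℕ) → ℕ
total {zero}  g = g []
total {suc m} g = total (g ∘ (false ∷_)) ℕ.+ total (g ∘ (true ∷_))

total-mono-≤ : ∀ {m} {g h : Cube m → ℕ} → (∀ x → g x ℕ.≤ h x) → total g ℕ.≤ total h
total-mono-≤ {zero}  g≤h = g≤h []
total-mono-≤ {suc m} g≤h = ℕ.+-mono-≤ (total-mono-≤ (g≤h ∘ (false ∷_)))
                                      (total-mono-≤ (g≤h ∘ (true ∷_)))

total-+ : ∀ {m} (g h : Cube m → ℕ) → total (λ x → g x ℕ.+ h x) ≡ total g ℕ.+ total h
total-+ {zero}  g h = refl
total-+ {suc m} g h = trans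
  (cong₂ ℕ._+_ (total-+ (g ∘ (false ∷_)) (h ∘ (false ∷_)))
               (total-+ (g ∘ (true ∷_)) (h ∘ (true ∷_))))
  (interchange (total (g ∘ (false ∷_))) _ _ _)
  where
  open ℕSolver.+-*-Solver
  interchange : ∀ a b c d → (a ℕ.+ b) ℕ.+ (c ℕ.+ d) ≡ (a ℕ.+ c) ℕ.+ (b ℕ.+ d)
  interchange = solve 4 (λ a b c d → (a :+ b) :+ (c :+ d) := (a :+ c) :+ (b :+ d)) refl

term≤total : ∀ {m} (g : Cube m → ℕ) x → g x ℕ.≤ total g
term≤total g []          = ℕ.≤-refl
term≤total g (false ∷ x) = ℕ.≤-trans (term≤total (g ∘ (false ∷_)) x) (ℕ.m≤m+n _ _)
term≤total g (true ∷ x)  = ℕ.≤-trans (term≤total (g ∘ (true ∷_)) x) (ℕ.m≤n+m _ _)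

-- With a common factor `u`, sums of reals over the cube reduce to sums of natural numbers.
∑-ι : ∀ {m} (F : Cube m → ℝ) (g : Cube m → ℕ) u →
  (∀ x → F x ≋ fromℚ (ι (g x) ℚ.* u)) → ∑ F ≋ fromℚ (ι (total g) ℚ.* u)
∑-ι {zero}  F g u F≋g = F≋g []
∑-ι {suc m} F g u F≋g k = trans
  (cong₂ ℚ._+_ (∑-ι (F ∘ (false ∷_)) (g ∘ (false ∷_)) u (F≋g ∘ (false ∷_)) k)
               (∑-ι (F ∘ (true ∷_)) (g ∘ (true ∷_)) u (F≋g ∘ (true ∷_)) k))
  (trans (sym (ℚ.*-distribʳ-+ u (ι G₀) (ι G₁))) (cong (ℚ._* u) (sym (ι-+ G₀ G₁))))
  where
  G₀ = total (g ∘ (false ∷_))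
  G₁ = total (g ∘ (true ∷_))

-- Reading bits

Computes : ∀ {m} → DecisionTree m → (Cube m → Bool) → Set
Computes T f = ∀ x → run T x ≡ f x

xor≡false⇒≡ : ∀ a b → a xor b ≡ false → a ≡ b
xor≡false⇒≡ false false _ = refl
xor≡false⇒≡ true  true  _ = refl

path : ∀ {m} → DecisionTree m → Cube m → List (Fin m)
path (output b)      x = []
path (query i t₀ t₁) x = i ∷ (if lookup x i then path t₁ x else path t₀ x)

length-path : ∀ {m} (T : DecisionTree m) x → length (path T x) ≡ queries T x
length-path (output b)      x = refl
length-path (query i t₀ t₁) x with lookup x i
... | false = cong suc (length-path t₀ x)
... | true  = cong suc (length-path t₁ x)

_∈?_ : ∀ {m} (i : Fin m) xs → Dec (i ∈ xs)
_∈?_ = DecMembership._∈?_ Fin._≟_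

∈path⇒0<queries : ∀ {m} (T : DecisionTree m) {x i} → i ∈ path T x → ∀ x′ → 0 ℕ.< queries T x′
∈path⇒0<queries (query _ _ _) _ _ = s≤s z≤n

path-determines : ∀ {m} (T : DecisionTree m) x x′ →
  (∀ {i} → i ∈ path T x → lookup x′ i ≡ lookup x i) →
  run T x′ ≡ run T x × path T x′ ≡ path T x
path-determines (output b)      x x′ agree = refl , refl
path-determines (query i t₀ t₁) x x′ agree rewrite agree (here refl) with lookup x i
... | false = let r , p = path-determines t₀ x x′ (agree ∘ there) in r , cong (i ∷_) p
... | true  = let r , p = path-determines t₁ x x′ (agree ∘ there) in r , cong (i ∷_) p

∉path⇒flip-invariant : ∀ {m} (T : DecisionTree m) x i → i ∉ path T x →
  run T (x [ i ]%= not) ≡ run T x × path T (x [ i ]%= not) ≡ path T x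
∉path⇒flip-invariant T x i i∉ = path-determines T x (x [ i ]%= not)
  λ {j} j∈ → Vec.lookup∘updateAt′ j i (λ { refl → i∉ j∈ }) x

-- If bit `i` were not read, flipping it would leave the output unchanged, although the value of `f`
-- changes.
sensitive⇒∈path : ∀ {m} (T : DecisionTree m) f → Computes T f →
  ∀ x i → f (x [ i ]%= not) ≢ f x → i ∈ path T x
sensitive⇒∈path T f T-f x i sensitive = decidable-stable (i ∈? path T x)
  λ i∉ → sensitive (trans (sym (T-f _))
    (trans (proj₁ (∉path⇒flip-invariant T x i i∉)) (T-f x)))

-- Sending `i` to the position of an occurrence of `g i` in `xs` is injective. The list may contain
-- repetitions, as a tree may query a bit twice.
covering⇒≤length : ∀ {k m} {g : Fin k → Fin m} {xs} → Injective _≡_ _≡_ g →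
  (∀ i → g i ∈ xs) → k ℕ.≤ length xs
covering⇒≤length {xs = xs} g-inj g∈ = Fin.injective⇒≤ {f = λ i → index (g∈ i)} λ {i} {j} eq →
  g-inj (trans (lookup-index (g∈ i))
    (trans (cong (List.lookup xs) eq) (sym (lookup-index (g∈ j)))))

-- Complexity under a distribution of full support

module FullSupport {m} (w : Cube m → ℕ) (w>0 : ∀ x → 0 ℕ.< w x) where

  W : ℕ
  W = total w

  W>0 : 0 ℕ.< W
  W>0 = ℕ.≤-trans (w>0 (replicate m false)) (term≤total w _)

  private instance
    W-pos : Positive (ι W)
    W-pos = ℚ.normalize-pos W 1 {{_}} {{ℕ.>-nonZero W>0}}

    W≢0 : ℚ.NonZero (ι W)
    W≢0 = ℚ.pos⇒nonZero (ι W)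

  -- The probability carried by weight 1. All probabilities and means below are natural multiples of
  -- it, so a nonzero one is at least `unit`.
  unit : ℚ
  unit = 1/ ι W

  private instance
    unit-pos : Positive unit
    unit-pos = ℚ.1/pos⇒pos (ι W)

    unit-nonNeg : NonNegative unit
    unit-nonNeg = ℚ.pos⇒nonNeg unit

  0<unit : 0ℚ ℚ.< unit
  0<unit = ℚ.positive⁻¹ unit

  unit≤ι*unit : ∀ {n} → 0 ℕ.< n → unit ℚ.≤ ι n ℚ.* unit
  unit≤ι*unit {n} n>0 = subst (ℚ._≤ ι n ℚ.* unit) (ℚ.*-identityˡ unit)
    (ℚ.*-monoʳ-≤-nonNeg unit (ι-mono-≤ n>0))

  unit≤1 : unit ℚ.≤ 1ℚ
  unit≤1 = subst (unit ℚ.≤_) (ℚ.*-inverseʳ (ι W)) (unit≤ι*unit W>0)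

  -- Half of a lower bound for the smallest probability.
  ε : ℝ
  ε = fromℚ (½ ℚ.* unit)

  0<ε : 0ℝ < ε
  0<ε = ½ ℚ.* unit , half-pos 0<unit , 0 , λ _ _ → ℚ.≤-reflexive (ℚ.+-identityˡ _)

  ε<1 : ε < 1ℝ
  -- Since `unit` is at most 1, `ε` is at most ½, which leaves a gap of ½.
  ε<1 = ½ , ℚ.positive⁻¹ ½ , 0 , λ _ _ →
    ℚ.+-monoˡ-≤ ½ (ℚ.*-monoˡ-≤-nonNeg ½ unit≤1)

  density : Cube m → ℝ
  density x = fromℚ (ι (w x) ℚ.* unit)

  ∑-density : ∑ density ≋ 1ℝ
  ∑-density k = trans (∑-ι density w unit (λ _ _ → refl) k) (ℚ.*-inverseʳ (ι W))

  μ : Distribution m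
  μ = record
    { mass   = density
    ; mass≥0 = λ x → fromℚ-mono-≤ (ℚ.≤-trans (ℚ.<⇒≤ 0<unit) (unit≤ι*unit (w>0 x)))
    ; mass-∑ = ≋⇒≤ {∑ density} {1ℝ} ∑-density , ≋⇒≥ {∑ density} {1ℝ} ∑-density
    }

  full-support : ∀ x → x ∈supp μ
  full-support x = unit , 0<unit , 0 , λ _ _ →
    subst (ℚ._≤ ι (w x) ℚ.* unit) (sym (ℚ.+-identityˡ unit)) (unit≤ι*unit (w>0 x))

  weight : (Cube m → Bool) → ℕ
  weight event = total λ x → if event x then w x else 0

  cost : DecisionTree m → ℕ
  cost T = total λ x → w x ℕ.* queries T x

  mean : DecisionTree m → ℚ
  mean T = ι (cost T) ℚ.* unit

  cost≤⇒mean≤ : ∀ T k → cost T ℕ.≤ k ℕ.* W → mean T ℚ.≤ ι k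
  cost≤⇒mean≤ T k c≤kW = ℚ.≤-trans (ℚ.*-monoʳ-≤-nonNeg unit (ι-mono-≤ c≤kW))
    (ℚ.≤-reflexive (trans (cong (ℚ._* unit) (ι-* k W))
      (trans (ℚ.*-assoc (ι k) (ι W) unit)
        (trans (cong (ι k ℚ.*_) (ℚ.*-inverseʳ (ι W))) (ℚ.*-identityʳ (ι k))))))

  Pr-weight : ∀ event → Pr μ event ≋ fromℚ (ι (weight event) ℚ.* unit)
  Pr-weight event = ∑-ι _ _ unit λ x → pointwise (event x) x
    where
    pointwise : ∀ b x → (if b then density x else 0ℝ) ≋
      fromℚ (ι (if b then w x else 0) ℚ.* unit)
    pointwise true  x k = refl
    pointwise false x k = sym (ℚ.*-zeroˡ unit)

  𝔼-cost : ∀ T → 𝔼 μ (queries T) ≋ fromℚ (mean T)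
  𝔼-cost T = ∑-ι _ _ unit λ x _ →
    trans (swap (ι (w x)) unit (ι (queries T x)))
      (cong (ℚ._* unit) (sym (ι-* (w x) (queries T x))))
    where
    open +-*-Solver
    swap : ∀ a b c → (a ℚ.* b) ℚ.* c ≡ (a ℚ.* c) ℚ.* b
    swap = solve 3 (λ a b c → (a :* b) :* c := (a :* c) :* b) refl

  -- All weights are positive, so an event of weight 0 contains no input.
  weightless⇒computes : ∀ {f} T → weight (errs f T) ≡ 0 → Computes T f
  weightless⇒computes {f} T eq x = xor≡false⇒≡ _ _ errs≡false
    where
    term≡0 : (if errs f T x then w x else 0) ≡ 0
    term≡0 = ℕ.n≤0⇒n≡0 (ℕ.≤-trans (term≤total _ x) (ℕ.≤-reflexive eq))
    errs≡false : errs f T x ≡ false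
    errs≡false with errs f T x | term≡0
    ... | false | _    = refl
    ... | true  | w≡0 = ⊥-elim (ℕ.<⇒≢ (w>0 x) (sym w≡0))

  computes⇒weightless : ∀ {f} T → Computes T f → weight (errs f T) ≡ 0
  computes⇒weightless {f} T T-f = total≡0 λ x → cong (if_then w x else 0)
    (trans (cong (_xor f x) (T-f x)) (Bool.xor-same (f x)))
    where
    total≡0 : ∀ {m} {g : Cube m → ℕ} → (∀ x → g x ≡ 0) → total g ≡ 0
    total≡0 {zero}  g≡0 = g≡0 []
    total≡0 {suc m} g≡0 = cong₂ ℕ._+_ (total≡0 (g≡0 ∘ (false ∷_))) (total≡0 (g≡0 ∘ (true ∷_)))

  computes⇒Pr≋0 : ∀ {f} T → Computes T f → Pr μ (errs f T) ≋ 0ℝ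
  computes⇒Pr≋0 {f} T T-f k = trans (Pr-weight (errs f T) k)
    (trans (cong (λ n → ι n ℚ.* unit) (computes⇒weightless T T-f)) (ℚ.*-zeroˡ unit))

  -- A positive multiple of `unit` is at least `unit`, above `ε`, which is half of it. Comparing
  -- reals yields a rational inequality only up to a slack; a quarter of `unit` is small enough to
  -- keep the contradiction.
  below-ε⇒≡0 : ∀ n → fromℚ (ι n ℚ.* unit) ≤ ε → n ≡ 0
  below-ε⇒≡0 zero    _   = refl
  below-ε⇒≡0 (suc n) n≤ε = ⊥-elim (ℚ.<-irrefl refl (ℚ.≤-<-trans unit≤¾unit ¾unit<unit))
    where
    quarter : ℚ
    quarter = ½ ℚ.* (½ ℚ.* unit)
    0<quarter : 0ℚ ℚ.< quarter
    0<quarter = half-pos (half-pos 0<unit)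
    unit≤¾unit : unit ℚ.≤ ½ ℚ.* unit ℚ.+ quarter
    unit≤¾unit = ℚ.≤-trans (unit≤ι*unit (s≤s (z≤n {n})))
      (fromℚ-cancel-≤ {ι (suc n) ℚ.* unit} {½ ℚ.* unit} n≤ε quarter 0<quarter)
    ¾unit<unit : ½ ℚ.* unit ℚ.+ quarter ℚ.< unit
    ¾unit<unit = subst (½ ℚ.* unit ℚ.+ quarter ℚ.<_) (half+half unit)
      (ℚ.+-monoʳ-< (½ ℚ.* unit)
        (subst₂ ℚ._<_ (ℚ.+-identityʳ quarter) (half+half (½ ℚ.* unit))
          (ℚ.+-monoʳ-< quarter 0<quarter)))

  Pr≤ε⇒computes : ∀ f T → Pr μ (errs f T) ≤ ε → Computes T f
  Pr≤ε⇒computes f T Pr≤ε = weightless⇒computes T (below-ε⇒≡0 (weight (errs f T))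
    (≤-trans {fromℚ (ι (weight (errs f T)) ℚ.* unit)} {Pr μ (errs f T)} {ε}
      (≋⇒≥ {Pr μ (errs f T)} {fromℚ (ι (weight (errs f T)) ℚ.* unit)} (Pr-weight (errs f T))) Pr≤ε))

  module _ (f : Cube m → Bool) (T₀ : DecisionTree m) (T₀-f : Computes T₀ f) where

    module _ (optimal : ∀ T → Computes T f → cost T₀ ℕ.≤ cost T) where

      penalized-cost : ∀ T → cost T₀ ℕ.≤ cost T ℕ.+ cost T₀ ℕ.* weight (errs f T)
      penalized-cost T with weight (errs f T) in eq
      ... | zero  = ℕ.≤-trans (optimal T (weightless⇒computes T eq)) (ℕ.m≤m+n _ _)
      -- The erroneous weight is at least 1, so the penalty alone already covers `cost T₀`.
      ... | suc e = ℕ.≤-trans (ℕ.m≤m*n (cost T₀) (suc e)) (ℕ.m≤n+m _ (cost T))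

      penalized-mean : ∀ T → mean T₀ ℚ.≤
        mean T ℚ.+ ι (cost T₀) ℚ.* (ι (weight (errs f T)) ℚ.* unit)
      penalized-mean T = ℚ.≤-trans (ℚ.*-monoʳ-≤-nonNeg unit (ι-mono-≤ (penalized-cost T)))
        (ℚ.≤-reflexive (trans
          (cong (ℚ._* unit) (trans (ι-+ (cost T) _)
            (cong (ι (cost T) ℚ.+_) (ι-* (cost T₀) (weight (errs f T))))))
          (distribute (ι (cost T)) (ι (cost T₀)) (ι (weight (errs f T))) unit)))
        where
        open +-*-Solver
        distribute : ∀ a b c u →
          (a ℚ.+ b ℚ.* c) ℚ.* u ≡ a ℚ.* u ℚ.+ b ℚ.* (c ℚ.* u)
        distribute = solve 4 (λ a b c u →
          (a :+ b :* c) :* u := a :* u :+ b :* (c :* u)) refl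

      isD̄₀ : IsD̄₀ μ f (fromℚ (mean T₀))
      isD̄₀ = penalized⇒IsD̄₀ μ f
        (λ T → ι (weight (errs f T)) ℚ.* unit) (λ T → Pr-weight (errs f T))
        mean 𝔼-cost
        T₀ (trans (cong (λ n → ι n ℚ.* unit) (computes⇒weightless T₀ T₀-f)) (ℚ.*-zeroˡ unit))
        (ι (cost T₀)) {{ι-nonNeg (cost T₀)}}
        {{ℚ.nonNeg*nonNeg⇒nonNeg (ι (cost T₀)) {{ι-nonNeg (cost T₀)}} unit}}
        penalized-mean

    -- `x₀` is a worst input for `T₀`. A competitor with error at most `ε` is exact, so it needs as
    -- many queries on `x₀`, and `x₀` lies in the support.
    isD : ∀ x₀ → (∀ x → queries T₀ x ℕ.≤ queries T₀ x₀) →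
      (∀ T → Computes T f → queries T₀ x₀ ℕ.≤ queries T x₀) →
      IsD μ ε f (queries T₀ x₀)
    isD x₀ worst necessary =
      (T₀ , ≤-trans {Pr μ (errs f T₀)} {0ℝ} {ε}
              (≋⇒≤ {Pr μ (errs f T₀)} {0ℝ} (computes⇒Pr≋0 T₀ T₀-f))
              (fromℚ-mono-≤ (ℚ.<⇒≤ (half-pos 0<unit)))
          , (x₀ , full-support x₀ , refl) , λ x _ → worst x)
      , λ q (T , Pr≤ε , _ , ≤q) →
          ℕ.≤-trans (necessary T (Pr≤ε⇒computes f T Pr≤ε)) (≤q x₀ (full-support x₀))

-- What is needed for each m, stated in natural numbers only: `optimal` and `cheap` settle the
-- average-case complexity and bound it by 2, while `worst` and `necessary` identify the
-- distributional complexity as the number of queries on `x₀`.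
record Separation (m : ℕ) : Set where
  field
    f         : Cube m → Bool
    w         : Cube m → ℕ
    w>0       : ∀ x → 0 ℕ.< w x
    T₀        : DecisionTree m
    computes  : Computes T₀ f
    optimal   : ∀ T → Computes T f → FullSupport.cost w w>0 T₀ ℕ.≤ FullSupport.cost w w>0 T
    x₀        : Cube m
    worst     : ∀ x → queries T₀ x ℕ.≤ queries T₀ x₀
    necessary : ∀ T → Computes T f → queries T₀ x₀ ℕ.≤ queries T x₀
    cheap     : FullSupport.cost w w>0 T₀ ℕ.≤ 2 ℕ.* total w

-- The hard functions

parity : ∀ {n} → Cube n → Bool
parity []      = false
parity (b ∷ y) = b xor parity y

parity-flip : ∀ {n} (y : Cube n) i → parity (y [ i ]%= not) ≡ not (parity y)
parity-flip (b ∷ y) zero    = sym (Bool.not-distribˡ-xor b (parity y))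
parity-flip (b ∷ y) (suc i) = trans (cong (b xor_) (parity-flip y i))
  (sym (Bool.not-distribʳ-xor b (parity y)))

-- Renumbers the variables to make room for a new first bit that is never queried.
shift : ∀ {m} → DecisionTree m → DecisionTree (suc m)
shift (output b)      = output b
shift (query i t₀ t₁) = query (suc i) (shift t₀) (shift t₁)

run-shift : ∀ {m} (T : DecisionTree m) b x → run (shift T) (b ∷ x) ≡ run T x
run-shift (output _)      b x = refl
run-shift (query i t₀ t₁) b x = cong₂ (if lookup x i then_else_) (run-shift t₁ b x) (run-shift t₀ b x)

queries-shift : ∀ {m} (T : DecisionTree m) b x → queries (shift T) (b ∷ x) ≡ queries T x
queries-shift (output _)      b x = refl
queries-shift (query i t₀ t₁) b x =
  cong suc (cong₂ (if lookup x i then_else_) (queries-shift t₁ b x) (queries-shift t₀ b x))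

readAll : ∀ {n} → (Cube n → Bool) → DecisionTree n
readAll {zero}  g = output (g [])
readAll {suc n} g = query zero (shift (readAll (g ∘ (false ∷_)))) (shift (readAll (g ∘ (true ∷_))))

readAll-computes : ∀ {n} (g : Cube n → Bool) → Computes (readAll g) g
readAll-computes g []          = refl
readAll-computes g (false ∷ x) = trans (run-shift (readAll (g ∘ (false ∷_))) false x) (readAll-computes (g ∘ (false ∷_)) x)
readAll-computes g (true ∷ x)  = trans (run-shift (readAll (g ∘ (true ∷_))) true x) (readAll-computes (g ∘ (true ∷_)) x)

queries-readAll : ∀ {n} (g : Cube n → Bool) x → queries (readAll g) x ≡ n
queries-readAll g []          = refl
queries-readAll g (false ∷ x) =
  cong suc (trans (queries-shift (readAll (g ∘ (false ∷_))) false x) (queries-readAll _ x))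
queries-readAll g (true ∷ x)  =
  cong suc (trans (queries-shift (readAll (g ∘ (true ∷_))) true x) (queries-readAll _ x))

constant : ∀ m → Separation m
constant m = record
  { f         = λ _ → false
  ; w         = λ _ → 1
  ; w>0       = λ _ → s≤s z≤n
  ; T₀        = output false
  ; computes  = λ _ → refl
  ; optimal   = λ _ _ → total-mono-≤ {m} λ _ → z≤n
  ; x₀        = replicate m false
  ; worst     = λ _ → z≤n
  ; necessary = λ _ _ → z≤n
  ; cheap     = ℕ.≤-trans (total-mono-≤ {m} λ _ → z≤n) (ℕ.m≤m+n _ _)
  }

module Gated (n : ℕ) (n≥2 : 2 ℕ.≤ n) where

  gatedParity : Cube (suc n) → Bool
  gatedParity (b ∷ y) = b ∧ parity y

  gateFirst : DecisionTree (suc n)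
  gateFirst = query zero (output false) (shift (readAll parity))

  w : Cube (suc n) → ℕ
  w (false ∷ y) = n
  w (true ∷ y)  = 1

  w>0 : ∀ x → 0 ℕ.< w x
  w>0 (false ∷ y) = ℕ.≤-trans (s≤s z≤n) n≥2
  w>0 (true ∷ y)  = s≤s z≤n

  open FullSupport w w>0 using (W; cost)

  gateFirst-computes : Computes gateFirst gatedParity
  gateFirst-computes (false ∷ y) = refl
  gateFirst-computes (true ∷ y)  = trans (run-shift (readAll parity) true y) (readAll-computes parity y)

  queries-gateFirst : ∀ y → queries gateFirst (true ∷ y) ≡ suc n
  queries-gateFirst y = cong suc (trans (queries-shift (readAll parity) true y) (queries-readAll parity y))

  cost-by-y : ∀ T → cost T ≡
    total λ y → n ℕ.* queries T (false ∷ y) ℕ.+ 1 ℕ.* queries T (true ∷ y)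
  cost-by-y T = sym (total-+ {n} _ _)

  module _ (T : DecisionTree (suc n)) (T-f : Computes T gatedParity) where

    -- With the gate open the value is the parity of `y`, which is sensitive to every bit.
    reads-y : ∀ y i → suc i ∈ path T (true ∷ y)
    reads-y y i = sensitive⇒∈path T gatedParity T-f (true ∷ y) (suc i)
      (Bool.not-¬ refl ∘ sym ∘ trans (sym (parity-flip y i)))

    n≤queries : ∀ y → n ℕ.≤ queries T (true ∷ y)
    n≤queries y = subst (n ℕ.≤_) (length-path T (true ∷ y))
      (covering⇒≤length Fin.suc-injective (reads-y y))

    -- Together with the bits of `y`, the gate bit completes the set of all `suc n` variables, so
    -- the identity is the required injection.
    reads-b⇒n<queries : ∀ y → zero ∈ path T (true ∷ y) → n ℕ.< queries T (true ∷ y)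
    reads-b⇒n<queries y b∈ = subst (suc n ℕ.≤_) (length-path T (true ∷ y))
      (covering⇒≤length (λ eq → eq) λ { zero → b∈ ; (suc i) → reads-y y i })

    -- The left side is the weighted cost of `gateFirst` on the two inputs that share `y`, written
    -- in the form to which `cost-gateFirst` brings its total.
    pair-bound : ∀ y → n ℕ.* 1 ℕ.+ 1 ℕ.* suc n ℕ.≤
      n ℕ.* queries T (false ∷ y) ℕ.+ 1 ℕ.* queries T (true ∷ y)
    pair-bound y with zero ∈? path T (true ∷ y)
    ... | yes b∈ = ℕ.+-mono-≤ (ℕ.*-monoʳ-≤ n (∈path⇒0<queries T b∈ (false ∷ y)))
                              (ℕ.*-monoʳ-≤ 1 (reads-b⇒n<queries y b∈))
    ... | no b∉ = ℕ.≤-trans numeric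
        (ℕ.+-mono-≤ (ℕ.*-monoʳ-≤ n (subst (n ℕ.≤_) same (n≤queries y)))
                    (ℕ.*-monoʳ-≤ 1 (n≤queries y)))
      where
      same : queries T (true ∷ y) ≡ queries T (false ∷ y)
      same = trans (sym (length-path T (true ∷ y)))
        -- Flipping the bit `zero` of `true ∷ y` gives `false ∷ y` by computation.
        (trans (cong length (sym (proj₂ (∉path⇒flip-invariant T (true ∷ y) zero b∉))))
          (length-path T (false ∷ y)))
      open ℕ.≤-Reasoning
      open ℕSolver.+-*-Solver
      numeric : n ℕ.* 1 ℕ.+ 1 ℕ.* suc n ℕ.≤ n ℕ.* n ℕ.+ 1 ℕ.* n
      numeric = begin
        n ℕ.* 1 ℕ.+ 1 ℕ.* suc n
          ≡⟨ solve 1 (λ n → n :* con 1 :+ con 1 :* (con 1 :+ n) := n :* con 2 :+ con 1) refl n ⟩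
        n ℕ.* 2 ℕ.+ 1
          -- Both places use `n≥2`: once for the factor 2, once for 1 being at most `n`.
          ≤⟨ ℕ.+-mono-≤ (ℕ.*-monoʳ-≤ n n≥2) (ℕ.≤-trans (s≤s z≤n) n≥2) ⟩
        n ℕ.* n ℕ.+ n
          ≡⟨ cong (n ℕ.* n ℕ.+_) (sym (ℕ.*-identityˡ n)) ⟩
        n ℕ.* n ℕ.+ 1 ℕ.* n ∎

    -- Closing the gate changes the value from true to false when `y` has odd parity.
    reads-b : ∀ y → parity y ≡ true → zero ∈ path T (true ∷ y)
    reads-b y odd = sensitive⇒∈path T gatedParity T-f (true ∷ y) zero λ eq → absurd (trans eq odd)
      where
      absurd : false ≢ true
      absurd ()

  cost-gateFirst : cost gateFirst ≡ total {n} λ _ → n ℕ.* 1 ℕ.+ 1 ℕ.* suc n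
  cost-gateFirst = trans (cost-by-y gateFirst) (total-cong λ y →
    cong (λ q → n ℕ.* 1 ℕ.+ 1 ℕ.* q) (queries-gateFirst y))
    where
    total-cong : ∀ {m} {g h : Cube m → ℕ} → (∀ x → g x ≡ h x) → total g ≡ total h
    total-cong {zero}  g≡h = g≡h []
    total-cong {suc m} g≡h = cong₂ ℕ._+_ (total-cong (g≡h ∘ (false ∷_))) (total-cong (g≡h ∘ (true ∷_)))

  gateFirst-optimal : ∀ T → Computes T gatedParity → cost gateFirst ℕ.≤ cost T
  gateFirst-optimal T T-f = subst₂ ℕ._≤_ (sym cost-gateFirst) (sym (cost-by-y T))
    (total-mono-≤ (pair-bound T T-f))

  -- For each `y` the two inputs have weight `n` + 1 and cost 2`n` + 1, just below twice the weight.
  gateFirst-cheap : cost gateFirst ℕ.≤ 2 ℕ.* W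
  gateFirst-cheap = begin
    cost gateFirst
      ≡⟨ cost-gateFirst ⟩
    total {n} (λ _ → n ℕ.* 1 ℕ.+ 1 ℕ.* suc n)
      ≤⟨ total-mono-≤ {n} (λ _ → bound) ⟩
    total {n} (λ _ → (n ℕ.+ 1) ℕ.+ (n ℕ.+ 1))
      ≡⟨ total-+ {n} _ _ ⟩
    total {n} (λ _ → n ℕ.+ 1) ℕ.+ total {n} (λ _ → n ℕ.+ 1)
      -- `W` unfolds along the gate bit into the totals of the constants `n` and 1.
      ≡⟨ cong (λ t → t ℕ.+ t) (total-+ {n} _ _) ⟩
    W ℕ.+ W
      ≡⟨ cong (W ℕ.+_) (sym (ℕ.+-identityʳ W)) ⟩
    2 ℕ.* W ∎
    where
    open ℕ.≤-Reasoning
    open ℕSolver.+-*-Solver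
    bound : n ℕ.* 1 ℕ.+ 1 ℕ.* suc n ℕ.≤ (n ℕ.+ 1) ℕ.+ (n ℕ.+ 1)
    bound = ℕ.≤-trans (ℕ.n≤1+n _) (ℕ.≤-reflexive
      (solve 1 (λ n → con 1 :+ (n :* con 1 :+ con 1 :* (con 1 :+ n)) :=
        (n :+ con 1) :+ (n :+ con 1)) refl n))

  gateFirst-worst : ∀ y x → queries gateFirst x ℕ.≤ queries gateFirst (true ∷ y)
  gateFirst-worst y (false ∷ z) = s≤s z≤n
  gateFirst-worst y (true ∷ z)  =
    ℕ.≤-reflexive (trans (queries-gateFirst z) (sym (queries-gateFirst y)))

  separation : (y : Cube n) → parity y ≡ true → Separation (suc n)
  separation y odd = record
    { f         = gatedParity
    ; w         = w
    ; w>0       = w>0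
    ; T₀        = gateFirst
    ; computes  = gateFirst-computes
    ; optimal   = gateFirst-optimal
    ; x₀        = true ∷ y
    ; worst     = gateFirst-worst y
    ; necessary = λ T T-f → subst (ℕ._≤ queries T (true ∷ y)) (sym (queries-gateFirst y))
        (reads-b⇒n<queries T T-f y (reads-b T T-f y odd))
    ; cheap     = gateFirst-cheap
    }

-- The sequence of functions

parity-zeros : ∀ n → parity (replicate n false) ≡ false
parity-zeros zero    = refl
parity-zeros (suc n) = parity-zeros n

-- Gated.pair-bound needs n ≥ 2, hence the constant function when m ≤ 2.
separation : ∀ m → Separation m
separation (suc (suc (suc k))) =
  Gated.separation (suc (suc k)) (s≤s (s≤s z≤n))
    -- A single 1 among zeros gives odd parity.
    (true ∷ replicate (suc k) false) (cong not (parity-zeros (suc k)))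
separation m = constant m

fact1 : Σ ((m : ℕ) → Cube m → Bool) λ f →
    Σ ((m : ℕ) → Distribution m) λ μ →
    Σ (ℕ → ℝ) λ ε →
    ((m : ℕ) → 0ℝ < ε m × ε m < 1ℝ)
    × (Σ (ℕ → ℝ) λ D̄₀ →
    ((m : ℕ) → IsD̄₀ (μ m) (f m) (D̄₀ m)) × (D̄₀ =O (λ _ → 1ℝ)))
    × (Σ (ℕ → ℕ) λ D →
    ((m : ℕ) → IsD (μ m) (ε m) (f m) (D m)) × ((λ m → fromℕ (D m)) =Ω fromℕ))
fact1 =
  (λ m → f (S m)) , (λ m → μ (w (S m)) (w>0 (S m))) , (λ m → ε (w (S m)) (w>0 (S m)))
  , (λ m → 0<ε (w (S m)) (w>0 (S m)) , ε<1 (w (S m)) (w>0 (S m)))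
  , ( (λ m → fromℚ (mean (w (S m)) (w>0 (S m)) (T₀ (S m))))
    , (λ m → isD̄₀ (w (S m)) (w>0 (S m)) (f (S m)) (T₀ (S m)) (computes (S m)) (optimal (S m)))
    -- The constant 2 comes from `cheap`, which holds for every m, so the threshold is 0.
    , fromℚ (ι 2) , 0 , λ m _ → bounded m)
  , ( (λ m → queries (T₀ (S m)) (x₀ (S m)))
    , (λ m → isD (w (S m)) (w>0 (S m)) (f (S m)) (T₀ (S m)) (computes (S m))
               (x₀ (S m)) (worst (S m)) (necessary (S m)))
    -- The threshold 3 skips the constant functions, which take no queries; from there on the
    -- complexity is exactly m, so the factor is 1.
    , 1ℝ , 0<1 , 3 , linear)
  where
  open Separation
  open FullSupport using (μ; ε; 0<ε; ε<1; mean; cost≤⇒mean≤; isD̄₀; isD)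

  S : ∀ m → Separation m
  S = separation

  bounded : ∀ m → fromℚ (mean (w (S m)) (w>0 (S m)) (T₀ (S m))) ≤ fromℚ (ι 2) * 1ℝ
  bounded m = begin
    fromℚ q           ≲⟨ fromℚ-mono-≤ {q} {ι 2} (cost≤⇒mean≤ (w (S m)) (w>0 (S m)) (T₀ (S m)) 2 (cheap (S m))) ⟩
    fromℚ (ι 2)       ≈⟨ (λ _ → sym (ℚ.*-identityʳ (ι 2))) ⟩
    fromℚ (ι 2) * 1ℝ  ∎
    where
    open ≤-Reasoning
    q = mean (w (S m)) (w>0 (S m)) (T₀ (S m))

  0<1 : 0ℝ < 1ℝ
  0<1 = ½ , ℚ.positive⁻¹ ½ , 0 , λ _ _ → ℚ.≤ᵇ⇒≤ {0ℚ ℚ.+ ½} {1ℚ} _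

  linear : ∀ m → 3 ℕ.≤ m → 1ℝ * fromℕ m ≤ fromℕ (queries (T₀ (S m)) (x₀ (S m)))
  linear 1 (s≤s ())
  linear 2 (s≤s (s≤s ()))
  linear m@(suc (suc (suc k))) _ = ≋⇒≤ {1ℝ * fromℕ m} {fromℕ (queries (T₀ (S m)) (x₀ (S m)))} λ _ → trans (ℚ.*-identityˡ (ι m))
    (cong ι (sym (Gated.queries-gateFirst (suc (suc k)) (s≤s (s≤s z≤n))
      (true ∷ replicate (suc k) false))))
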